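{- For every $n\ge0$, $$|\mathcal{B}_{n+1}(213)|=\sum_{j=0}^{n}|\mathcal{G}(n;0,j)|.$$
   Context: A ballot permutation is a $\pi\in\mathfrak{S}_m$ such that every prefix $\pi_1\cdots\pi_i$ has at most as many descents ($\pi_j>\pi_{j+1}$) as ascents ($\pi_j<\pi_{j+1}$); $\mathcal{B}_m$ denotes the set of them, and $\mathcal{B}_m(213)$ the subset of those having no subsequence order-isomorphic to $213$. A Gessel walk is a lattice path confined to $\mathbb{N}^2$ with steps from $\{(0,1),(0,-1),(1,1),(-1,-1)\}$. $\mathcal{G}(n;i,j)$ is the set of $n$-step Gessel walks starting at $(0,i)$ and ending at $(0,j)$. -}

module Defs where

open import Data.Fin.Base using (Fin; _<_)
open import Data.Fin.Patterns using (0F; 1F; 2F)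
import Data.Fin.Properties as Fin
open import Data.Integer.Base as ℤ using (ℤ; +_; 0ℤ; 1ℤ; -1ℤ)
import Data.Integer.Properties as ℤ
open import Data.List.Base using (List; []; _∷_; length; filter; zip; drop; inits; allFin; cartesianProductWith)
open import Data.List.Membership.Propositional using (_∈_; find; lose)
open import Data.List.Membership.Propositional.Properties using (∈-allFin; ∈-cartesianProductWith⁺)
import Data.List.Relation.Unary.All as All
open import Data.List.Relation.Unary.All using (All)
open import Data.List.Relation.Unary.Any as Any using (here; there)
import Data.List.Relation.Unary.AllPairs as AllPairs
open import Data.List.Relation.Unary.Enumerates.Setoid using (IsEnumeration)
open import Data.List.Relation.Unary.Unique.Propositional using (Unique)
open import Data.List.Relation.Unary.Unique.Propositional.Properties using (allFin⁺; cartesianProductWith⁺)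
open import Data.Nat.Base as ℕ using (ℕ; zero; suc)
import Data.Nat.Properties as ℕ
open import Data.Product.Base using (∃; _×_; _,_; proj₁; proj₂)
open import Data.Product.Properties using (≡-dec)
open import Data.Vec.Base as Vec using (Vec; []; _∷_; lookup; toList)
open import Data.Vec.Properties using (∷-injective)
open import Data.Vec.Relation.Unary.AllPairs using (allPairs?) renaming (AllPairs to AllPairsᵛ)
open import Function.Bundles using (_⇔_; mk⇔; Equivalence)
open import Function.Definitions using (Bijective)
open import Level using (0ℓ)
open import Relation.Binary.PropositionalEquality using (_≡_; refl; setoid)
open import Relation.Nullary using (Dec; ¬_)
open import Relation.Nullary.Decidable using (map′; ¬?; _×-dec_; _→-dec_)
open import Relation.Unary using (Pred; Decidable)

private
  variable
    A : Set
    k l m n : ℕ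

record Finite (A : Set) : Set where
  field
    elements : List A
    complete : IsEnumeration (setoid A) elements
    unique   : Unique elements

open Finite

-- The enumeration lists every element exactly once, so this is the number of
-- x : A with P x; proofs of P x are not counted with multiplicity.
∣_∣ : ⦃ Finite A ⦄ → {P : Pred A 0ℓ} → Decidable P → ℕ
∣_∣ ⦃ fin ⦄ P? = length (filter P? (elements fin))

∃? : ⦃ Finite A ⦄ → {P : Pred A 0ℓ} → Decidable P → Dec (∃ P)
∃? ⦃ fin ⦄ P? =
  map′ (λ any → let (x , _ , px) = find any in x , px)
       (λ (x , px) → lose (complete fin x) px)
       (Any.any? P? (elements fin))

instance
  finite-Fin : Finite (Fin n)
  finite-Fin {n} = record
    { elements = allFin n ; complete = ∈-allFin ; unique = allFin⁺ n }

  finite-Vec : ⦃ Finite A ⦄ → Finite (Vec A n)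
  finite-Vec {n = zero} = record
    { elements = [] ∷ []
    ; complete = λ { [] → here refl }
    ; unique   = All.[] AllPairs.∷ AllPairs.[]
    }
  finite-Vec {A} {suc n} ⦃ fin ⦄ = record
    { elements = cartesianProductWith _∷_ (elements fin) (elements rec)
    ; complete = λ { (x ∷ xs) → ∈-cartesianProductWith⁺ _∷_ (complete fin x) (complete rec xs) }
    ; unique   = cartesianProductWith⁺ _∷_ ∷-injective (unique fin) (unique rec)
    }
    where
    rec : Finite (Vec A n)
    rec = finite-Vec

-- Permutations are in one-line notation, with values and positions both
-- numbered from 0 rather than from 1.
IsPermutation : Pred (Vec (Fin m) m) 0ℓ
IsPermutation π = Bijective _≡_ _≡_ (lookup π)

isPermutation? : Decidable (IsPermutation {m})
isPermutation? π = injective? ×-dec surjective?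
  where
  injective? = map′ (λ inj {i} {j} → inj i j) (λ inj i j → inj)
    (Fin.all? λ i → Fin.all? λ j → (lookup π i Fin.≟ lookup π j) →-dec (i Fin.≟ j))
  surjective? = map′
    (λ surj y → proj₁ (surj y) , λ { refl → proj₂ (surj y) })
    (λ surj y → proj₁ (surj y) , proj₂ (surj y) refl)
    (Fin.all? λ y → Fin.any? λ x → lookup π x Fin.≟ y)

consecutive : List A → List (A × A)
consecutive xs = zip xs (drop 1 xs)

ascents descents : List (Fin m) → ℕ
ascents  xs = length (filter (λ (x , y) → x Fin.<? y) (consecutive xs))
descents xs = length (filter (λ (x , y) → y Fin.<? x) (consecutive xs))

IsBallot : Pred (Vec (Fin m) n) 0ℓ
IsBallot π = All (λ prefix → descents prefix ℕ.≤ ascents prefix) (inits (toList π))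

isBallot? : Decidable (IsBallot {m} {n})
isBallot? π = All.all? (λ prefix → descents prefix ℕ.≤? ascents prefix) (inits (toList π))

OrderIsomorphic : Vec (Fin l) k → Vec (Fin m) k → Set
OrderIsomorphic u v = ∀ i j → lookup u i < lookup u j ⇔ lookup v i < lookup v j

orderIsomorphic? : (u : Vec (Fin l) k) (v : Vec (Fin m) k) → Dec (OrderIsomorphic u v)
orderIsomorphic? u v = Fin.all? λ i → Fin.all? λ j →
  map′ (λ (f , g) → mk⇔ f g) (λ e → Equivalence.to e , Equivalence.from e)
    (((lookup u i Fin.<? lookup u j) →-dec (lookup v i Fin.<? lookup v j)) ×-dec
     ((lookup v i Fin.<? lookup v j) →-dec (lookup u i Fin.<? lookup u j)))

-- A subsequence is given by its strictly increasing vector of positions.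
Contains : Vec (Fin k) k → Pred (Vec (Fin m) n) 0ℓ
Contains {k} {n = n} σ π = ∃ λ (positions : Vec (Fin n) k) →
  AllPairsᵛ _<_ positions × OrderIsomorphic (Vec.map (lookup π) positions) σ

contains? : (σ : Vec (Fin k) k) → Decidable (Contains {k} {m} {n} σ)
contains? σ π = ∃? λ positions →
  allPairs? Fin._<?_ positions ×-dec orderIsomorphic? (Vec.map (lookup π) positions) σ

pattern213 : Vec (Fin 3) 3
pattern213 = 1F ∷ 0F ∷ 2F ∷ []

𝓑 : (m : ℕ) → Pred (Vec (Fin m) m) 0ℓ
𝓑 m π = IsPermutation π × IsBallot π

𝓑[_] : Vec (Fin k) k → (m : ℕ) → Pred (Vec (Fin m) m) 0ℓ
𝓑[ σ ] m π = 𝓑 m π × ¬ Contains σ π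

𝓑[_]? : (σ : Vec (Fin k) k) (m : ℕ) → Decidable (𝓑[ σ ] m)
𝓑[ σ ]? m π = (isPermutation? π ×-dec isBallot? π) ×-dec ¬? (contains? σ π)

Point : Set
Point = ℤ × ℤ

data Step : Set where
  N S NE SW : Step

displacement : Step → Point
displacement N  = 0ℤ  , 1ℤ
displacement S  = 0ℤ  , -1ℤ
displacement NE = 1ℤ  , 1ℤ
displacement SW = -1ℤ , -1ℤ

instance
  finite-Step : Finite Step
  finite-Step = record
    { elements = N ∷ S ∷ NE ∷ SW ∷ []
    ; complete = λ { N  → here refl
                   ; S  → there (here refl)
                   ; NE → there (there (here refl))
                   ; SW → there (there (there (here refl))) }
    ; unique   = ((λ ()) All.∷ (λ ()) All.∷ (λ ()) All.∷ All.[])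
                 AllPairs.∷ ((λ ()) All.∷ (λ ()) All.∷ All.[])
                 AllPairs.∷ ((λ ()) All.∷ All.[])
                 AllPairs.∷ All.[] AllPairs.∷ AllPairs.[]
    }

_⊕_ : Point → Point → Point
(x , y) ⊕ (x′ , y′) = x ℤ.+ x′ , y ℤ.+ y′

-- All n + 1 points visited, including both endpoints.
vertices : Point → Vec Step n → Vec Point (suc n)
vertices p []       = p ∷ []
vertices p (s ∷ ss) = p ∷ vertices (p ⊕ displacement s) ss

InQuadrant : Pred Point 0ℓ
InQuadrant (x , y) = 0ℤ ℤ.≤ x × 0ℤ ℤ.≤ y

inQuadrant? : Decidable InQuadrant
inQuadrant? (x , y) = (0ℤ ℤ.≤? x) ×-dec (0ℤ ℤ.≤? y)

-- Once the starting point is fixed, a walk is determined by its steps.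
𝓖 : (n i j : ℕ) → Pred (Vec Step n) 0ℓ
𝓖 n i j w = All InQuadrant (toList path) × Vec.last path ≡ (0ℤ , + j)
  where
  path : Vec Point (suc n)
  path = vertices (0ℤ , + i) w

𝓖? : (n i j : ℕ) → Decidable (𝓖 n i j)
𝓖? n i j w = All.all? inQuadrant? _ ×-dec ≡-dec ℤ._≟_ ℤ._≟_ _ _

{-# OPTIONS --safe #-}
-- Build a permutation from right to left, prepending a letter a to a permutation τ with the
-- letters ≥ a of τ raised by one.  The result avoids 213 iff τ does and a is a cut of τ: no
-- letter < a precedes a letter ≥ a.  The letter a makes a descent only if it is the new
-- maximum; otherwise a is a cut not above the first letter of τ.  Let k be the number of nonzero
-- cuts not above the first letter.  A descent turns k into k + 1, and the ascents turn k into
-- each of 0, …, k exactly once.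
--
-- Weight each permutation by the binomial coefficient C(k, x).  For a descent
-- C(k + 1, x) = C(k, x) + C(k, x − 1), matching the steps S and SW; for an ascent
-- Σ_{t ≤ k} C(t, x) = C(k + 1, x + 1) = C(k, x) + C(k, x + 1), matching N and NE.  Thus the
-- permutations that are ballot when started at height y, weighted by C(k, x), are
-- equinumerous with the Gessel walks from (x , y) to the vertical axis; take x = y = 0.
module Submission where

open import Defs
open import Algebra.Properties.CommutativeSemigroup using () renaming (interchange to ∙-interchange)
open import Data.Bool.Base using (if_then_else_)
open import Data.Fin.Base as Fin using (Fin; zero; suc; toℕ; fromℕ; punchIn; punchOut)
open import Data.Fin.Patterns using (0F; 1F; 2F)
import Data.Fin.Properties as Fin
open import Data.Integer.Base as ℤ using (0ℤ; -1ℤ) renaming (+_ to pos)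
import Data.Integer.Properties as ℤ
open import Data.List.Base as List
  using (List; []; _∷_; _++_; map; upTo; allFin; filter; length; inits; cartesianProductWith)
open import Data.List.Membership.Propositional using (_∈_)
open import Data.List.Membership.Propositional.Properties
  using (∈-allFin; ∈-filter⁺; ∈-filter⁻; ∈-cartesianProductWith⁺; ∈-cartesianProductWith⁻)
open import Data.List.Membership.Propositional.Properties.WithK using (unique∧set⇒bag)
import Data.List.Properties as List
open import Data.List.Relation.Binary.BagAndSetEquality using (∼bag⇒↭)
open import Data.List.Relation.Binary.Permutation.Propositional.Properties using (↭-length)
open import Data.List.Relation.Unary.All as All using (All; []; _∷_)
import Data.List.Relation.Unary.All.Properties as All
open import Data.List.Relation.Unary.AllPairs using ([]; _∷_)
open import Data.List.Relation.Unary.Any using (here; there)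
open import Data.List.Relation.Unary.Unique.Propositional using (Unique)
open import Data.List.Relation.Unary.Unique.Propositional.Properties using (allFin⁺; cartesianProductWith⁺; filter⁺)
open import Data.Nat.Base
open import Data.Nat.Combinatorics using (_C_; nCk+nC[k+1]≡[n+1]C[k+1]; k>n⇒nCk≡0)
open import Data.Nat.ListAction using (sum)
open import Data.Nat.ListAction.Properties using (sum-++)
open import Data.Nat.Properties
open import Data.Product.Base using (_×_; _,_; proj₁; proj₂; ∃)
open import Data.Product.Function.NonDependent.Propositional using (_×-⇔_)
open import Data.Product.Properties using (≡-dec)
open import Data.Unit.Base using (⊤; tt)
open import Data.Vec.Base as Vec using (Vec; []; _∷_; lookup; toList)
import Data.Vec.Properties as Vec
open import Data.Vec.Relation.Unary.All as Allᵛ using ([]; _∷_)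
import Data.Vec.Relation.Unary.All.Properties as Allᵛ
open import Data.Vec.Relation.Unary.AllPairs as AllPairsᵛ using ([]; _∷_; allPairs?) renaming (AllPairs to AllPairsᵛ)
import Data.Vec.Relation.Unary.AllPairs.Properties as AllPairsᵛ
open import Function.Base using (_∘_; id)
open import Function.Bundles using (_⇔_; mk⇔; Equivalence)
open import Function.Construct.Composition using (_⇔-∘_)
open import Function.Construct.Identity using (⇔-id)
open import Function.Construct.Symmetry using (⇔-sym)
open import Function.Definitions using (Injective)
open import Function.Related.TypeIsomorphisms using (¬-cong-⇔)
open import Level using (0ℓ)
open import Relation.Binary.Core using (Rel)
open import Relation.Binary.PropositionalEquality
open import Relation.Nullary using (Dec; yes; no; does; ¬_; contradiction)
open import Relation.Nullary.Decidable using (_×-dec_; ¬?; does-⇔; dec-true; dec-false)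
open import Relation.Unary using (Pred; Decidable)

open Equivalence using (to; from)
open Finite
open ≡-Reasoning

private
  variable
    A B D : Set
    l m n : ℕ

-- Sums and indicators

∑ : List A → (A → ℕ) → ℕ
∑ xs f = sum (map f xs)

∑-cong-∈ : ∀ (xs : List A) {f g : A → ℕ} → (∀ x → x ∈ xs → f x ≡ g x) → ∑ xs f ≡ ∑ xs g
∑-cong-∈ []       eq = refl
∑-cong-∈ (x ∷ xs) eq = cong₂ _+_ (eq x (here refl)) (∑-cong-∈ xs λ z → eq z ∘ there)

∑-cong : ∀ (xs : List A) {f g : A → ℕ} → (∀ x → f x ≡ g x) → ∑ xs f ≡ ∑ xs g
∑-cong xs eq = ∑-cong-∈ xs λ x _ → eq x

∑-+ : ∀ (xs : List A) (f g : A → ℕ) → ∑ xs (λ x → f x + g x) ≡ ∑ xs f + ∑ xs g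
∑-+ []       f g = refl
∑-+ (x ∷ xs) f g = begin
  f x + g x + ∑ xs (λ x → f x + g x) ≡⟨ cong (f x + g x +_) (∑-+ xs f g) ⟩
  f x + g x + (∑ xs f + ∑ xs g)      ≡⟨ ∙-interchange +-commutativeSemigroup (f x) (g x) _ _ ⟩
  f x + ∑ xs f + (g x + ∑ xs g)      ∎

∑-*ˡ : ∀ c (xs : List A) (f : A → ℕ) → ∑ xs (λ x → c * f x) ≡ c * ∑ xs f
∑-*ˡ c []       f = sym (*-zeroʳ c)
∑-*ˡ c (x ∷ xs) f = trans (cong (c * f x +_) (∑-*ˡ c xs f)) (sym (*-distribˡ-+ c (f x) _))

∑-zero : ∀ (xs : List A) → ∑ xs (λ _ → 0) ≡ 0
∑-zero []       = refl
∑-zero (x ∷ xs) = ∑-zero xs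

∑-++ : ∀ (xs ys : List A) (f : A → ℕ) → ∑ (xs ++ ys) f ≡ ∑ xs f + ∑ ys f
∑-++ xs ys f = trans (cong sum (List.map-++ f xs ys)) (sum-++ (map f xs) (map f ys))

∑-map : ∀ (g : A → B) (xs : List A) (f : B → ℕ) → ∑ (map g xs) f ≡ ∑ xs (f ∘ g)
∑-map g xs f = cong sum (sym (List.map-∘ xs))

∑-cartesianProductWith : ∀ (g : A → B → D) xs ys (f : D → ℕ) →
  ∑ (cartesianProductWith g xs ys) f ≡ ∑ xs (λ x → ∑ ys (λ y → f (g x y)))
∑-cartesianProductWith g []       ys f = refl
∑-cartesianProductWith g (x ∷ xs) ys f =
  trans (∑-++ (map (g x) ys) _ f)
        (cong₂ _+_ (∑-map (g x) ys f) (∑-cartesianProductWith g xs ys f))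

∑-allFin-suc : ∀ m (f : Fin (suc m) → ℕ) → ∑ (allFin (suc m)) f ≡ f zero + ∑ (allFin m) (f ∘ suc)
∑-allFin-suc m f = cong (f zero +_)
  (trans (cong (λ xs → ∑ xs f) (sym (List.map-tabulate id suc))) (∑-map suc (allFin m) f))

∑-upTo-suc : ∀ b (f : ℕ → ℕ) → ∑ (upTo (suc b)) f ≡ f 0 + ∑ (upTo b) (f ∘ suc)
∑-upTo-suc b f = cong (f 0 +_)
  (trans (cong (λ xs → ∑ xs f) (sym (List.map-upTo suc b))) (∑-map suc (upTo b) f))

∑-upTo-last : ∀ b (f : ℕ → ℕ) → ∑ (upTo (suc b)) f ≡ ∑ (upTo b) f + f b
∑-upTo-last b f = begin
  ∑ (upTo (suc b)) f         ≡⟨ cong (λ xs → ∑ xs f) (List.upTo-∷ʳ b) ⟨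
  ∑ (upTo b List.∷ʳ b) f     ≡⟨ ∑-++ (upTo b) _ f ⟩
  ∑ (upTo b) f + (f b + 0)   ≡⟨ cong (∑ (upTo b) f +_) (+-identityʳ (f b)) ⟩
  ∑ (upTo b) f + f b         ∎

-- Shaped for the choice of a new first letter: the letters below `b` will be the ascents, the top
-- letter the only possible descent, and the letters between contribute nothing.
∑-allFin-split : ∀ {m} b (g : Fin (suc m) → ℕ) (f : ℕ → ℕ) → b ≤ m →
  (∀ a → toℕ a < b → g a ≡ f (toℕ a)) →
  (∀ a → b ≤ toℕ a → toℕ a < m → g a ≡ 0) →
  ∑ (allFin (suc m)) g ≡ ∑ (upTo b) f + g (fromℕ m)
∑-allFin-split {zero}  zero    g f _         low mid = +-identityʳ (g zero)
∑-allFin-split {suc m} zero    g f _         low mid = begin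
  ∑ (allFin (2 + m)) g
    ≡⟨ ∑-allFin-suc (suc m) g ⟩
  g zero + ∑ (allFin (suc m)) (g ∘ suc)
    ≡⟨ cong₂ _+_ (mid zero z≤n z<s)
         (∑-allFin-split 0 (g ∘ suc) f z≤n (λ _ ()) (λ a _ a<m → mid (suc a) z≤n (s<s a<m))) ⟩
  g (fromℕ (suc m))
    ∎
∑-allFin-split {suc m} (suc b) g f (s≤s b≤m) low mid = begin
  ∑ (allFin (2 + m)) g
    ≡⟨ ∑-allFin-suc (suc m) g ⟩
  g zero + ∑ (allFin (suc m)) (g ∘ suc)
    ≡⟨ cong₂ _+_ (low zero z<s) (∑-allFin-split b (g ∘ suc) (f ∘ suc) b≤m
         (λ a a<b → low (suc a) (s<s a<b)) (λ a b≤a a<m → mid (suc a) (s≤s b≤a) (s<s a<m))) ⟩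
  f 0 + (∑ (upTo b) (f ∘ suc) + g (fromℕ (suc m)))
    ≡⟨ +-assoc (f 0) _ _ ⟨
  f 0 + ∑ (upTo b) (f ∘ suc) + g (fromℕ (suc m))
    ≡⟨ cong (_+ g (fromℕ (suc m))) (∑-upTo-suc b f) ⟨
  ∑ (upTo (suc b)) f + g (fromℕ (suc m))
    ∎

⟦_⟧ : {P : Set} → Dec P → ℕ
⟦ P? ⟧ = if does P? then 1 else 0

⟦⟧-⇔ : {P Q : Set} (P? : Dec P) (Q? : Dec Q) → P ⇔ Q → ⟦ P? ⟧ ≡ ⟦ Q? ⟧
⟦⟧-⇔ P? Q? P⇔Q = cong (if_then 1 else 0) (does-⇔ P⇔Q P? Q?)

⟦⟧-true : {P : Set} (P? : Dec P) → P → ⟦ P? ⟧ ≡ 1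
⟦⟧-true P? p = cong (if_then 1 else 0) (dec-true P? p)

⟦⟧-false : {P : Set} (P? : Dec P) → ¬ P → ⟦ P? ⟧ ≡ 0
⟦⟧-false P? ¬p = cong (if_then 1 else 0) (dec-false P? ¬p)

⟦⟧-× : {P Q : Set} (P? : Dec P) (Q? : Dec Q) → ⟦ P? ×-dec Q? ⟧ ≡ ⟦ P? ⟧ * ⟦ Q? ⟧
⟦⟧-× (yes _) (yes _) = refl
⟦⟧-× (yes _) (no  _) = refl
⟦⟧-× (no  _) _       = refl

length-filter-∑ : ∀ {P : Pred A 0ℓ} (P? : Decidable P) xs → length (filter P? xs) ≡ ∑ xs (λ x → ⟦ P? x ⟧)
length-filter-∑ P? [] = refl
length-filter-∑ P? (x ∷ xs) with P? x
... | yes _ = cong suc (length-filter-∑ P? xs)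
... | no  _ = length-filter-∑ P? xs

module _ {P : Pred ℕ 0ℓ} (P? : Decidable P) where

  -- The count runs over 1, ..., b and leaves out 0, so that for cuts it yields the number k of
  -- nonzero ones.
  count⁺ : ℕ → ℕ
  count⁺ zero    = 0
  count⁺ (suc b) = ⟦ P? (suc b) ⟧ + count⁺ b

  -- As c runs through the elements of `P` from 0 to b, `count⁺ c` starts at 0 because of `P 0` and
  -- grows by one at each further element, so it takes each value up to `count⁺ b` exactly once.
  ∑-count⁺ : P 0 → ∀ φ b →
    ∑ (upTo (suc b)) (λ c → ⟦ P? c ⟧ * φ (count⁺ c)) ≡ ∑ (upTo (suc (count⁺ b))) φ
  ∑-count⁺ p₀ φ zero rewrite dec-true (P? 0) p₀ = cong (_+ 0) (+-identityʳ (φ 0))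
  ∑-count⁺ p₀ φ (suc b)
    rewrite ∑-upTo-last (suc b) (λ c → ⟦ P? c ⟧ * φ (count⁺ c)) | ∑-count⁺ p₀ φ b
    with P? (suc b)
  ... | yes _ = trans (cong (∑ (upTo (suc (count⁺ b))) φ +_) (+-identityʳ _))
                      (sym (∑-upTo-last (suc (count⁺ b)) φ))
  ... | no  _ = +-identityʳ _

count⁺-cong : ∀ {P Q : Pred ℕ 0ℓ} (P? : Decidable P) (Q? : Decidable Q) b →
  (∀ {c} → c ≤ b → P c ⇔ Q c) → count⁺ P? b ≡ count⁺ Q? b
count⁺-cong P? Q? zero    P⇔Q = refl
count⁺-cong P? Q? (suc b) P⇔Q = cong₂ _+_
  (⟦⟧-⇔ (P? (suc b)) (Q? (suc b)) (P⇔Q ≤-refl))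
  (count⁺-cong P? Q? b λ c≤b → P⇔Q (m≤n⇒m≤1+n c≤b))

count⁺-extend : ∀ {P : Pred ℕ 0ℓ} (P? : Decidable P) {b d} → b ≤′ d →
  (∀ {c} → b < c → c ≤ d → ¬ P c) → count⁺ P? d ≡ count⁺ P? b
count⁺-extend P? ≤′-refl                      ¬P = refl
count⁺-extend P? {d = suc d} (≤′-step b≤d) ¬P = cong₂ _+_
  (⟦⟧-false (P? (suc d)) (¬P (s≤s (≤′⇒≤ b≤d)) ≤-refl))
  (count⁺-extend P? b≤d λ b<c c≤d → ¬P b<c (m≤n⇒m≤1+n c≤d))

-- Gessel walks

-- `𝓖` with an arbitrary starting point, as recursion on the first step requires.
WalkTo : Point → ℕ → Pred (Vec Step n) 0ℓ
WalkTo p j w = All InQuadrant (toList (vertices p w)) × Vec.last (vertices p w) ≡ (0ℤ , pos j)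

walkTo? : ∀ p j → Decidable (WalkTo {n} p j)
walkTo? p j w = All.all? inQuadrant? _ ×-dec ≡-dec ℤ._≟_ ℤ._≟_ _ _

walkTo-∷ : ∀ {p j} s {w : Vec Step n} → InQuadrant p → WalkTo p j (s ∷ w) ⇔ WalkTo (p ⊕ displacement s) j w
walkTo-∷ s p∈ℕ² = mk⇔ (λ { (_ ∷ all , end) → all , end }) (λ (all , end) → p∈ℕ² ∷ all , end)

walkTo⇒inQuadrant : ∀ {p j} {w : Vec Step n} → WalkTo p j w → InQuadrant p
walkTo⇒inQuadrant {w = []}    (p∈ℕ² ∷ _ , _) = p∈ℕ²
walkTo⇒inQuadrant {w = _ ∷ _} (p∈ℕ² ∷ _ , _) = p∈ℕ²

stepSequences : ∀ n → List (Vec Step n)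
stepSequences n = elements finite-Vec

-- The bound `b` on the final height is a separate parameter, so that it can stay fixed while the
-- starting point moves.
walks : ℕ → Point → ℕ → ℕ
walks n p b = ∑ (upTo b) (λ j → ∑ (stepSequences n) (λ w → ⟦ walkTo? p j w ⟧))

walks-outside : ∀ n {p} b → ¬ InQuadrant p → walks n p b ≡ 0
walks-outside n {p} b p∉ℕ² = trans
  (∑-cong (upTo b) λ j → trans
    (∑-cong (stepSequences n) λ w → ⟦⟧-false (walkTo? p j w) (p∉ℕ² ∘ walkTo⇒inQuadrant))
    (∑-zero (stepSequences n)))
  (∑-zero (upTo b))

walks-suc : ∀ n {p} b → InQuadrant p → walks (suc n) p b ≡
  walks n (p ⊕ displacement N) b + (walks n (p ⊕ displacement S) b +
  (walks n (p ⊕ displacement NE) b + walks n (p ⊕ displacement SW) b))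
walks-suc n {p} b p∈ℕ² = begin
  walks (suc n) p b
    ≡⟨ ∑-cong (upTo b) byFirstStep ⟩
  ∑ (upTo b) (λ j → after N j + (after S j + (after NE j + after SW j)))
    ≡⟨ ∑-+ (upTo b) (after N) _ ⟩
  ∑ (upTo b) (after N) + ∑ (upTo b) (λ j → after S j + (after NE j + after SW j))
    ≡⟨ cong (λ t → ∑ (upTo b) (after N) + t) (∑-+ (upTo b) (after S) _) ⟩
  ∑ (upTo b) (after N) + (∑ (upTo b) (after S) + ∑ (upTo b) (λ j → after NE j + after SW j))
    ≡⟨ cong (λ t → ∑ (upTo b) (after N) + (∑ (upTo b) (after S) + t)) (∑-+ (upTo b) (after NE) _) ⟩
  ∑ (upTo b) (after N) + (∑ (upTo b) (after S) + (∑ (upTo b) (after NE) + ∑ (upTo b) (after SW)))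
    ∎
  where
  after : Step → ℕ → ℕ
  after s j = ∑ (stepSequences n) (λ w → ⟦ walkTo? (p ⊕ displacement s) j w ⟧)

  startingWith : Step → ℕ → ℕ
  startingWith s j = ∑ (stepSequences n) (λ w → ⟦ walkTo? p j (s ∷ w) ⟧)

  startingWith≡after : ∀ s j → startingWith s j ≡ after s j
  startingWith≡after s j = ∑-cong (stepSequences n) λ w →
    ⟦⟧-⇔ (walkTo? p j (s ∷ w)) (walkTo? (p ⊕ displacement s) j w) (walkTo-∷ s p∈ℕ²)

  byFirstStep : ∀ j → ∑ (stepSequences (suc n)) (λ w → ⟦ walkTo? p j w ⟧)
                    ≡ after N j + (after S j + (after NE j + after SW j))
  byFirstStep j = begin
    ∑ (stepSequences (suc n)) (λ w → ⟦ walkTo? p j w ⟧)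
      ≡⟨ ∑-cartesianProductWith _∷_ (elements finite-Step) (stepSequences n) (λ w → ⟦ walkTo? p j w ⟧) ⟩
    ∑ (elements finite-Step) (λ s → startingWith s j)
      ≡⟨ ∑-cong (elements finite-Step) (λ s → startingWith≡after s j) ⟩
    after N j + (after S j + (after NE j + (after SW j + 0)))
      ≡⟨ cong (λ t → after N j + (after S j + (after NE j + t))) (+-identityʳ _) ⟩
    after N j + (after S j + (after NE j + after SW j))
      ∎

-- Evaluation at the predecessor, with value 0 at the wall: a step that leaves the quadrant begins
-- no walk.
below : ℕ → (ℕ → ℕ) → ℕ
below zero    f = 0
below (suc y) f = f y

-- The number of n-step Gessel walks from (x, y) to the vertical axis; the four summands are the
-- first steps N, S, NE and SW.
gessel : ℕ → ℕ → ℕ → ℕ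
gessel zero    zero    y = 1
gessel zero    (suc x) y = 0
gessel (suc n) x y =
  gessel n x (suc y) + (below y (gessel n x) +
  (gessel n (suc x) (suc y) + below y (λ y′ → below x (λ x′ → gessel n x′ y′))))

inQuadrant : ∀ x y → InQuadrant (pos x , pos y)
inQuadrant x y = ℤ.+≤+ z≤n , ℤ.+≤+ z≤n

∑-⟦≡⟧ : ∀ {P : Pred ℕ 0ℓ} (P? : Decidable P) {i b} → i < b → (∀ j → P j ⇔ i ≡ j) →
  ∑ (upTo b) (λ j → ⟦ P? j ⟧) ≡ 1
∑-⟦≡⟧ P? {zero} {suc b} _ P⇔ = begin
  ∑ (upTo (suc b)) (λ j → ⟦ P? j ⟧)
    ≡⟨ ∑-upTo-suc b (λ j → ⟦ P? j ⟧) ⟩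
  ⟦ P? 0 ⟧ + ∑ (upTo b) (λ j → ⟦ P? (suc j) ⟧)
    ≡⟨ cong₂ _+_ (⟦⟧-true (P? 0) (from (P⇔ 0) refl))
         (∑-cong (upTo b) λ j → ⟦⟧-false (P? (suc j)) λ p → contradiction (to (P⇔ (suc j)) p) λ ()) ⟩
  1 + ∑ (upTo b) (λ _ → 0)
    ≡⟨ cong suc (∑-zero (upTo b)) ⟩
  1
    ∎
∑-⟦≡⟧ P? {suc i} {suc b} (s≤s i<b) P⇔ = begin
  ∑ (upTo (suc b)) (λ j → ⟦ P? j ⟧)
    ≡⟨ ∑-upTo-suc b (λ j → ⟦ P? j ⟧) ⟩
  ⟦ P? 0 ⟧ + ∑ (upTo b) (λ j → ⟦ P? (suc j) ⟧)
    ≡⟨ cong₂ _+_ (⟦⟧-false (P? 0) λ p → contradiction (to (P⇔ 0) p) λ ())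
         (∑-⟦≡⟧ (P? ∘ suc) i<b λ j → mk⇔ (suc-injective ∘ to (P⇔ (suc j))) (from (P⇔ (suc j)) ∘ cong suc)) ⟩
  1
    ∎

-- A step raises the height by at most one, so every walk ends at height at most y + n, and the
-- bound `b` cuts off no endpoint.
walks≡gessel : ∀ n x y {b} → y + n < b → walks n (pos x , pos y) b ≡ gessel n x y
walks≡gessel zero zero y {b} y<b =
  trans (∑-cong (upTo b) λ j → +-identityʳ _)
    (∑-⟦≡⟧ (λ j → walkTo? (0ℤ , pos y) j []) (subst (_< b) (+-identityʳ y) y<b)
      λ j → mk⇔ (λ { (_ , refl) → refl }) (λ { refl → inQuadrant 0 y ∷ [] , refl }))
walks≡gessel zero (suc x) y {b} y<b = trans
  (∑-cong (upTo b) λ j → trans (+-identityʳ _) (⟦⟧-false (walkTo? (pos (suc x) , pos y) j []) λ ()))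
  (∑-zero (upTo b))
walks≡gessel (suc n) x y {b} y+1+n<b = trans (walks-suc n b (inQuadrant x y))
  (cong₂ _+_ north (cong₂ _+_ (south y y+1+n<b) (cong₂ _+_ northeast (southwest x y y+1+n<b))))
  where
  up : suc y + n < b
  up = subst (_< b) (+-suc y n) y+1+n<b

  down : ∀ {y} → suc y + suc n < b → y + n < b
  down {y} = ≤-<-trans (+-mono-≤ (n≤1+n y) (n≤1+n n))

  north : walks n (pos (x + 0) , pos (y + 1)) b ≡ gessel n x (suc y)
  north rewrite +-identityʳ x | +-comm y 1 = walks≡gessel n x (suc y) up

  northeast : walks n (pos (x + 1) , pos (y + 1)) b ≡ gessel n (suc x) (suc y)
  northeast rewrite +-comm x 1 | +-comm y 1 = walks≡gessel n (suc x) (suc y) up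

  -- At coordinate 0 the integer sum computes to a negative number, which refutes `InQuadrant`; at a
  -- successor it computes to the predecessor.
  south : ∀ y → y + suc n < b → walks n (pos (x + 0) , pos y ℤ.+ -1ℤ) b ≡ below y (gessel n x)
  south zero    _ = walks-outside n b λ { (_ , ()) }
  south (suc y) h rewrite +-identityʳ x = walks≡gessel n x y (down h)

  southwest : ∀ x y → y + suc n < b →
    walks n (pos x ℤ.+ -1ℤ , pos y ℤ.+ -1ℤ) b ≡ below y (λ y′ → below x (λ x′ → gessel n x′ y′))
  southwest x       zero    _ = walks-outside n b λ { (_ , ()) }
  southwest zero    (suc y) _ = walks-outside n b λ { (() , _) }
  southwest (suc x) (suc y) h = walks≡gessel n x y (down h)

-- Permutations and 213-avoidance

-- Without repetitions, equal membership makes the lists permutations of each other. This trades the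
-- enumeration of all vectors for the inductive list `perms`.
Unique⇒length-≡ : {xs ys : List A} → Unique xs → Unique ys → (∀ {x} → x ∈ xs ⇔ x ∈ ys) →
  length xs ≡ length ys
Unique⇒length-≡ xs! ys! xs⇔ys = ↭-length (∼bag⇒↭ (unique∧set⇒bag xs! ys! xs⇔ys))

prepend : Vec (Fin n) n → Fin (suc n) → Vec (Fin (suc n)) (suc n)
prepend τ a = a ∷ Vec.map (punchIn a) τ

map-injective : ∀ {f : A → B} → Injective _≡_ _≡_ f → Injective _≡_ _≡_ (Vec.map {n = n} f)
map-injective inj {[]}     {[]}     eq = refl
map-injective inj {x ∷ xs} {y ∷ ys} eq =
  cong₂ _∷_ (inj (proj₁ (Vec.∷-injective eq))) (map-injective inj (proj₂ (Vec.∷-injective eq)))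

prepend-injective : ∀ {σ τ : Vec (Fin n) n} {a b} → prepend σ a ≡ prepend τ b → σ ≡ τ × a ≡ b
prepend-injective {a = a} eq with refl , eq′ ← Vec.∷-injective eq =
  map-injective (Fin.punchIn-injective a _ _) eq′ , refl

perms : ∀ n → List (Vec (Fin n) n)
perms zero    = [] ∷ []
perms (suc n) = cartesianProductWith prepend (perms n) (allFin (suc n))

perms-unique : ∀ n → Unique (perms n)
perms-unique zero    = [] ∷ []
perms-unique (suc n) = cartesianProductWith⁺ prepend prepend-injective (perms-unique n) (allFin⁺ (suc n))

lookup-prepend-suc : ∀ (τ : Vec (Fin n) n) a i → lookup (prepend τ a) (suc i) ≡ punchIn a (lookup τ i)
lookup-prepend-suc τ a i = Vec.lookup-map i (punchIn a) τ

prepend-isPermutation : ∀ {τ : Vec (Fin n) n} a → IsPermutation τ → IsPermutation (prepend τ a)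
prepend-isPermutation {n} {τ} a (inj , surj) = inj′ , surj′
  where
  inj′ : Injective _≡_ _≡_ (lookup (prepend τ a))
  inj′ {zero}  {zero}  eq = refl
  inj′ {zero}  {suc j} eq = contradiction (sym (trans eq (lookup-prepend-suc τ a j))) (Fin.punchInᵢ≢i a _)
  inj′ {suc i} {zero}  eq = contradiction (trans (sym (lookup-prepend-suc τ a i)) eq) (Fin.punchInᵢ≢i a _)
  inj′ {suc i} {suc j} eq = cong suc (inj (Fin.punchIn-injective a _ _
    (trans (sym (lookup-prepend-suc τ a i)) (trans eq (lookup-prepend-suc τ a j)))))

  surj′ : ∀ c → ∃ λ i → ∀ {j} → j ≡ i → lookup (prepend τ a) j ≡ c
  surj′ c with a Fin.≟ c
  ... | yes a≡c = zero , λ { refl → a≡c }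
  ... | no  a≢c with i , eq ← surj (punchOut a≢c) = suc i , λ { refl →
    trans (lookup-prepend-suc τ a i) (trans (cong (punchIn a) (eq refl)) (Fin.punchIn-punchOut a≢c)) }

∈-perms⁻ : ∀ {π : Vec (Fin n) n} → π ∈ perms n → IsPermutation π
∈-perms⁻ {zero}  {[]} _ = (λ { {()} }) , λ ()
∈-perms⁻ {suc n} π∈ with ∈-cartesianProductWith⁻ prepend (perms n) (allFin (suc n)) π∈
... | τ , a , τ∈ , _ , refl = prepend-isPermutation a (∈-perms⁻ τ∈)

isPermutation-prepend⁻ : ∀ {τ : Vec (Fin n) n} a → IsPermutation (prepend τ a) → IsPermutation τ
isPermutation-prepend⁻ {n} {τ} a (inj , surj) = inj′ , surj′
  where
  inj′ : Injective _≡_ _≡_ (lookup τ)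
  inj′ {i} {j} eq = Fin.suc-injective (inj
    (trans (lookup-prepend-suc τ a i) (trans (cong (punchIn a) eq) (sym (lookup-prepend-suc τ a j)))))

  surj′ : ∀ c → ∃ λ i → ∀ {j} → j ≡ i → lookup τ j ≡ c
  surj′ c with surj (punchIn a c)
  ... | zero  , eq = contradiction (sym (eq refl)) (Fin.punchInᵢ≢i a c)
  ... | suc i , eq = i , λ { refl →
    Fin.punchIn-injective a _ _ (trans (sym (lookup-prepend-suc τ a i)) (eq refl)) }

map-punchIn-surjective : ∀ a (ρ : Vec (Fin (suc n)) m) → (∀ i → a ≢ lookup ρ i) →
  ∃ λ τ → ρ ≡ Vec.map (punchIn a) τ
map-punchIn-surjective a []      a∉ρ = [] , refl
map-punchIn-surjective a (b ∷ ρ) a∉ρ with τ , eq ← map-punchIn-surjective a ρ (a∉ρ ∘ suc) =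
  punchOut (a∉ρ zero) ∷ τ , cong₂ _∷_ (sym (Fin.punchIn-punchOut (a∉ρ zero))) eq

∈-perms⁺ : ∀ {π : Vec (Fin n) n} → IsPermutation π → π ∈ perms n
∈-perms⁺ {zero}  {[]}    _ = here refl
∈-perms⁺ {suc n} {a ∷ ρ} perm
  -- By injectivity the first letter does not recur, so the tail lies in the image of `punchIn a`.
  with τ , refl ← map-punchIn-surjective a ρ (λ i eq → contradiction (proj₁ perm {zero} {suc i} eq) λ ())
  = ∈-cartesianProductWith⁺ prepend (∈-perms⁺ (isPermutation-prepend⁻ a perm)) (∈-allFin a)

-- `punchIn i` moves only the letters from i on, and moves them upwards, so none crosses a threshold
-- c ≤ i.
punchIn-below-⇔ : ∀ (i : Fin (suc n)) j {c} → c ≤ toℕ i → toℕ (punchIn i j) < c ⇔ toℕ j < c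
punchIn-below-⇔ zero    j       z≤n       = mk⇔ (λ ()) (λ ())
punchIn-below-⇔ (suc i) zero    c≤i       = ⇔-id _
punchIn-below-⇔ (suc i) (suc j) z≤n       = mk⇔ (λ ()) (λ ())
punchIn-below-⇔ (suc i) (suc j) (s≤s c≤i) = mk⇔ (s<s ∘ to ih ∘ s<s⁻¹) (s<s ∘ from ih ∘ s<s⁻¹)
  where ih = punchIn-below-⇔ i j c≤i

≮⇔≥ : ∀ {i j} → (¬ i < j) ⇔ j ≤ i
≮⇔≥ = mk⇔ ≮⇒≥ ≤⇒≯

punchIn-above-⇔ : ∀ (i : Fin (suc n)) j {c} → c ≤ toℕ i → c ≤ toℕ (punchIn i j) ⇔ c ≤ toℕ j
punchIn-above-⇔ i j c≤i = ≮⇔≥ ⇔-∘ (¬-cong-⇔ (punchIn-below-⇔ i j c≤i) ⇔-∘ ⇔-sym ≮⇔≥)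

punchIn-<-⇔ : ∀ (i : Fin (suc n)) j k → punchIn i j Fin.< punchIn i k ⇔ j Fin.< k
punchIn-<-⇔ i j k = mk⇔
  (λ lt → ≰⇒> (<⇒≱ lt ∘ Fin.punchIn-mono-≤ i k j))
  (λ lt → ≰⇒> (<⇒≱ lt ∘ Fin.punchIn-cancel-≤ i k j))

punchInᵢ<i-⇔ : ∀ (i : Fin (suc n)) j → punchIn i j Fin.< i ⇔ toℕ j < toℕ i
punchInᵢ<i-⇔ i j = punchIn-below-⇔ i j ≤-refl

-- `punchIn i` skips the value i, so a weak inequality with i becomes strict.
i<punchInᵢ-⇔ : ∀ (i : Fin (suc n)) j → i Fin.< punchIn i j ⇔ toℕ i ≤ toℕ j
i<punchInᵢ-⇔ i j = punchIn-above-⇔ i j ≤-refl ⇔-∘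
  mk⇔ <⇒≤ (λ i≤ → ≤∧≢⇒< i≤ (Fin.punchInᵢ≢i i j ∘ sym ∘ Fin.toℕ-injective))

allPairs-map : ∀ {R : Rel A 0ℓ} {Q : Rel B 0ℓ} {f : A → B} → (∀ x y → Q (f x) (f y) ⇔ R x y) →
  {xs : Vec A n} → AllPairsᵛ Q (Vec.map f xs) ⇔ AllPairsᵛ R xs
allPairs-map {R = R} {Q} {f} Q⇔R = mk⇔ map⁻ (AllPairsᵛ.map⁺ ∘ AllPairsᵛ.map λ {x} {y} → from (Q⇔R x y))
  where
  map⁻ : ∀ {n} {xs : Vec _ n} → AllPairsᵛ Q (Vec.map f xs) → AllPairsᵛ R xs
  map⁻ {xs = []}     []         = []
  map⁻ {xs = x ∷ xs} (px ∷ pxs) = Allᵛ.map (λ {y} → to (Q⇔R x y)) (Allᵛ.map⁻ px) ∷ map⁻ pxs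

allPairs-lookup : ∀ {R : Rel A 0ℓ} {xs : Vec A n} → AllPairsᵛ R xs →
  ∀ {i j} → i Fin.< j → R (lookup xs i) (lookup xs j)
allPairs-lookup (px ∷ pxs) {zero}  {suc j} _         = Allᵛ.lookup⁺ px j
allPairs-lookup (px ∷ pxs) {suc i} {suc j} (s≤s i<j) = allPairs-lookup pxs i<j

allPairs-tabulate : ∀ {R : Rel A 0ℓ} {xs : Vec A n} →
  (∀ {i j} → i Fin.< j → R (lookup xs i) (lookup xs j)) → AllPairsᵛ R xs
allPairs-tabulate {xs = []}     r = []
allPairs-tabulate {xs = x ∷ xs} r = Allᵛ.lookup⁻ (λ j → r {zero} {suc j} z<s) ∷ allPairs-tabulate (r ∘ s<s)

-- With `a` placed in front of the word, a forbidden pair p, q completes a 213 in which `a` plays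
-- the 2.
NoStraddle : Fin m → Pred (Vec (Fin m) n) 0ℓ
NoStraddle a = AllPairsᵛ (λ p q → ¬ (p Fin.< a × a Fin.< q))

Avoids213 : Pred (Vec (Fin m) n) 0ℓ
Avoids213 []      = ⊤
Avoids213 (a ∷ π) = NoStraddle a π × Avoids213 π

avoids213? : Decidable (Avoids213 {m} {n})
avoids213? []      = yes tt
avoids213? (a ∷ π) = allPairs? (λ p q → ¬? ((p Fin.<? a) ×-dec (a Fin.<? q))) π ×-dec avoids213? π

avoids213-lookup : ∀ {π : Vec (Fin m) n} → Avoids213 π → ∀ {i j k} → i Fin.< j → j Fin.< k →
  ¬ (lookup π j Fin.< lookup π i × lookup π i Fin.< lookup π k)
avoids213-lookup {π = a ∷ π} (a-ok , _) {zero}  {suc j} {suc k} _         (s≤s j<k) = allPairs-lookup a-ok j<k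
avoids213-lookup {π = a ∷ π} (_ , π-ok) {suc i} {suc j} {suc k} (s≤s i<j) (s≤s j<k) = avoids213-lookup π-ok i<j j<k

avoids213-tabulate : ∀ {π : Vec (Fin m) n} → (∀ {i j k} → i Fin.< j → j Fin.< k →
  ¬ (lookup π j Fin.< lookup π i × lookup π i Fin.< lookup π k)) → Avoids213 π
avoids213-tabulate {π = []}    ok = tt
avoids213-tabulate {π = a ∷ π} ok =
  allPairs-tabulate (λ j<k → ok z<s (s<s j<k)) , avoids213-tabulate (λ i<j j<k → ok (s<s i<j) (s<s j<k))

avoids213⇔¬contains : {π : Vec (Fin m) n} → Avoids213 π ⇔ (¬ Contains pattern213 π)
avoids213⇔¬contains {π = π} = mk⇔ avoids⇒
  (λ ¬contains → avoids213-tabulate λ i<j j<k π213 → ¬contains (occurrence i<j j<k π213))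
  where
  avoids⇒ : Avoids213 π → ¬ Contains pattern213 π
  avoids⇒ avoids (i ∷ j ∷ k ∷ [] , (i<j ∷ _ ∷ []) ∷ (j<k ∷ []) ∷ [] ∷ [] , iso) =
    -- In the pattern the second entry is below the first and the first below the third; these two
    -- comparisons already determine 213.
    avoids213-lookup avoids i<j j<k (from (iso 1F 0F) z<s , from (iso 0F 2F) (s<s z<s))

  occurrence : ∀ {i j k} → i Fin.< j → j Fin.< k → lookup π j Fin.< lookup π i × lookup π i Fin.< lookup π k →
    Contains pattern213 π
  occurrence {i} {j} {k} i<j j<k (πj<πi , πi<πk) =
    i ∷ j ∷ k ∷ [] , (i<j ∷ <-trans i<j j<k ∷ []) ∷ (j<k ∷ []) ∷ [] ∷ [] , iso
    where
    holds : ∀ {P Q : Set} → P → Q → P ⇔ Q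
    holds p q = mk⇔ (λ _ → q) (λ _ → p)

    fails : ∀ {P Q : Set} → ¬ P → ¬ Q → P ⇔ Q
    fails ¬p ¬q = mk⇔ (λ p → contradiction p ¬p) (λ q → contradiction q ¬q)

    iso : OrderIsomorphic (Vec.map (lookup π) (i ∷ j ∷ k ∷ [])) pattern213
    iso 0F 0F = fails (<-irrefl refl) (<-irrefl refl)
    iso 0F 1F = fails (<-asym πj<πi) λ ()
    iso 0F 2F = holds πi<πk (s<s z<s)
    iso 1F 0F = holds πj<πi z<s
    iso 1F 1F = fails (<-irrefl refl) (<-irrefl refl)
    iso 1F 2F = holds (<-trans πj<πi πi<πk) z<s
    iso 2F 0F = fails (<-asym πi<πk) λ { (s≤s ()) }
    iso 2F 1F = fails (<-asym (<-trans πj<πi πi<πk)) λ ()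
    iso 2F 2F = fails (<-irrefl refl) (<-irrefl refl)

avoids213-map : ∀ {f : Fin l → Fin m} → (∀ p q → f p Fin.< f q ⇔ p Fin.< q) →
  {π : Vec (Fin l) n} → Avoids213 (Vec.map f π) ⇔ Avoids213 π
avoids213-map f-< {[]}    = mk⇔ id id
avoids213-map f-< {a ∷ π} = allPairs-map (λ p q → ¬-cong-⇔ (f-< p a ×-⇔ f-< a q)) ×-⇔ avoids213-map f-<

-- Ballot sequences

all-⇔ : ∀ {P Q : Pred A 0ℓ} → (∀ x → P x ⇔ Q x) → ∀ {xs} → All P xs ⇔ All Q xs
all-⇔ P⇔Q = mk⇔ (All.map λ {x} → to (P⇔Q x)) (All.map λ {x} → from (P⇔Q x))

all-inits-∷ : ∀ {P : Pred (List A) 0ℓ} x xs → All P (inits (x ∷ xs)) ⇔ (P [] × All (P ∘ (x ∷_)) (inits xs))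
all-inits-∷ x xs = mk⇔ (λ { (p ∷ ps) → p , All.map⁻ ps }) (λ (p , ps) → p ∷ All.map⁺ ps)

all-inits-map : ∀ {P : Pred (List B) 0ℓ} (f : A → B) xs → All P (inits (map f xs)) ⇔ All (P ∘ map f) (inits xs)
all-inits-map f []       = mk⇔ (λ { (p ∷ []) → p ∷ [] }) (λ { (p ∷ []) → p ∷ [] })
all-inits-map f (x ∷ xs) =
  ⇔-sym (all-inits-∷ x xs) ⇔-∘ ((⇔-id _ ×-⇔ all-inits-map f xs) ⇔-∘ all-inits-∷ (f x) (map f xs))

-- A word built from right to left is a suffix of the final one, so it may start with a surplus of y
-- ascents. For y = 0 this unfolds to `IsBallot`.
IsBallotFrom : ℕ → Pred (List (Fin m)) 0ℓ
IsBallotFrom y xs = All (λ prefix → descents prefix ≤ y + ascents prefix) (inits xs)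

isBallotFrom? : ∀ y → Decidable (IsBallotFrom {m} y)
isBallotFrom? y xs = All.all? (λ prefix → descents prefix ≤? y + ascents prefix) (inits xs)

ascents-∷∷ : ∀ (a b : Fin m) xs → ascents (a ∷ b ∷ xs) ≡ ⟦ a Fin.<? b ⟧ + ascents (b ∷ xs)
ascents-∷∷ a b xs = trans
  (length-filter-∑ (λ (x , y) → x Fin.<? y) (consecutive (a ∷ b ∷ xs)))
  (cong (⟦ a Fin.<? b ⟧ +_) (sym (length-filter-∑ (λ (x , y) → x Fin.<? y) (consecutive (b ∷ xs)))))

descents-∷∷ : ∀ (a b : Fin m) xs → descents (a ∷ b ∷ xs) ≡ ⟦ b Fin.<? a ⟧ + descents (b ∷ xs)
descents-∷∷ a b xs = trans
  (length-filter-∑ (λ (x , y) → y Fin.<? x) (consecutive (a ∷ b ∷ xs)))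
  (cong (⟦ b Fin.<? a ⟧ +_) (sym (length-filter-∑ (λ (x , y) → y Fin.<? x) (consecutive (b ∷ xs)))))

module _ {a b : Fin m} (xs : List (Fin m)) where

  ascents-< : a Fin.< b → ascents (a ∷ b ∷ xs) ≡ suc (ascents (b ∷ xs))
  ascents-< a<b = trans (ascents-∷∷ a b xs) (cong (_+ ascents (b ∷ xs)) (⟦⟧-true (a Fin.<? b) a<b))

  ascents-≮ : ¬ a Fin.< b → ascents (a ∷ b ∷ xs) ≡ ascents (b ∷ xs)
  ascents-≮ a≮b = trans (ascents-∷∷ a b xs) (cong (_+ ascents (b ∷ xs)) (⟦⟧-false (a Fin.<? b) a≮b))

  descents-> : b Fin.< a → descents (a ∷ b ∷ xs) ≡ suc (descents (b ∷ xs))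
  descents-> b<a = trans (descents-∷∷ a b xs) (cong (_+ descents (b ∷ xs)) (⟦⟧-true (b Fin.<? a) b<a))

  descents-≯ : ¬ b Fin.< a → descents (a ∷ b ∷ xs) ≡ descents (b ∷ xs)
  descents-≯ b≮a = trans (descents-∷∷ a b xs) (cong (_+ descents (b ∷ xs)) (⟦⟧-false (b Fin.<? a) b≮a))

-- Prefixes with fewer than two letters have no descent, so their conditions are void.
isBallotFrom-∷∷ : ∀ {y} {a b : Fin m} {xs} →
  IsBallotFrom y (a ∷ b ∷ xs) ⇔
  (All (λ prefix → descents (a ∷ b ∷ prefix) ≤ y + ascents (a ∷ b ∷ prefix)) (inits xs))
isBallotFrom-∷∷ {a = a} {b} {xs} = mk⇔
  (λ ballot → proj₂ (to (all-inits-∷ b xs) (proj₂ (to (all-inits-∷ a (b ∷ xs)) ballot))))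
  (λ ballot → from (all-inits-∷ a (b ∷ xs)) (z≤n , from (all-inits-∷ b xs) (z≤n , ballot)))

isBallotFrom-∷ : ∀ {y} {b : Fin m} {xs} →
  IsBallotFrom y (b ∷ xs) ⇔
  (All (λ prefix → descents (b ∷ prefix) ≤ y + ascents (b ∷ prefix)) (inits xs))
isBallotFrom-∷ {b = b} {xs} = mk⇔ (proj₂ ∘ to (all-inits-∷ b xs)) (λ ballot → from (all-inits-∷ b xs) (z≤n , ballot))

-- The pair a, b adds one ascent to every prefix containing both, which is the same as one more unit
-- of starting height.
isBallotFrom-ascent : ∀ {y} {a b : Fin m} {xs} → a Fin.< b →
  IsBallotFrom y (a ∷ b ∷ xs) ⇔ IsBallotFrom (suc y) (b ∷ xs)
isBallotFrom-ascent {y = y} {a} {b} a<b = ⇔-sym isBallotFrom-∷ ⇔-∘ (all-⇔ step ⇔-∘ isBallotFrom-∷∷)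
  where
  step : ∀ xs → descents (a ∷ b ∷ xs) ≤ y + ascents (a ∷ b ∷ xs) ⇔ descents (b ∷ xs) ≤ suc y + ascents (b ∷ xs)
  step xs rewrite ascents-< xs a<b | descents-≯ xs (<-asym a<b) | +-suc y (ascents (b ∷ xs)) = ⇔-id _

isBallotFrom-descent : ∀ {y} {a b : Fin m} {xs} → b Fin.< a →
  IsBallotFrom (suc y) (a ∷ b ∷ xs) ⇔ IsBallotFrom y (b ∷ xs)
isBallotFrom-descent {y = y} {a} {b} b<a = ⇔-sym isBallotFrom-∷ ⇔-∘ (all-⇔ step ⇔-∘ isBallotFrom-∷∷)
  where
  step : ∀ xs → descents (a ∷ b ∷ xs) ≤ suc y + ascents (a ∷ b ∷ xs) ⇔ descents (b ∷ xs) ≤ y + ascents (b ∷ xs)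
  step xs rewrite ascents-≮ xs (<-asym b<a) | descents-> xs b<a = mk⇔ s≤s⁻¹ s≤s

-- The two-letter prefix already has one descent and no ascent.
¬isBallotFrom-descent : ∀ {a b : Fin m} {xs} → b Fin.< a → ¬ IsBallotFrom 0 (a ∷ b ∷ xs)
¬isBallotFrom-descent {a = a} {b} b<a (_ ∷ _ ∷ short ∷ _)
  rewrite ascents-≮ [] (<-asym b<a) | descents-> [] b<a = contradiction short λ ()

module _ {f : Fin l → Fin m} (f-< : ∀ p q → f p Fin.< f q ⇔ p Fin.< q) where

  ascents-map : ∀ xs → ascents (map f xs) ≡ ascents xs
  ascents-map []           = refl
  ascents-map (x ∷ [])     = refl
  ascents-map (x ∷ y ∷ xs) = begin
    ascents (map f (x ∷ y ∷ xs))
      ≡⟨ ascents-∷∷ (f x) (f y) (map f xs) ⟩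
    ⟦ f x Fin.<? f y ⟧ + ascents (map f (y ∷ xs))
      ≡⟨ cong₂ _+_ (⟦⟧-⇔ (f x Fin.<? f y) (x Fin.<? y) (f-< x y)) (ascents-map (y ∷ xs)) ⟩
    ⟦ x Fin.<? y ⟧ + ascents (y ∷ xs)
      ≡⟨ ascents-∷∷ x y xs ⟨
    ascents (x ∷ y ∷ xs)
      ∎

  descents-map : ∀ xs → descents (map f xs) ≡ descents xs
  descents-map []           = refl
  descents-map (x ∷ [])     = refl
  descents-map (x ∷ y ∷ xs) = begin
    descents (map f (x ∷ y ∷ xs))
      ≡⟨ descents-∷∷ (f x) (f y) (map f xs) ⟩
    ⟦ f y Fin.<? f x ⟧ + descents (map f (y ∷ xs))
      ≡⟨ cong₂ _+_ (⟦⟧-⇔ (f y Fin.<? f x) (y Fin.<? x) (f-< y x)) (descents-map (y ∷ xs)) ⟩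
    ⟦ y Fin.<? x ⟧ + descents (y ∷ xs)
      ≡⟨ descents-∷∷ x y xs ⟨
    descents (x ∷ y ∷ xs)
      ∎

  isBallotFrom-map : ∀ {y xs} → IsBallotFrom y (map f xs) ⇔ IsBallotFrom y xs
  isBallotFrom-map {y} {xs} = all-⇔ step ⇔-∘ all-inits-map f xs
    where
    step : ∀ xs → descents (map f xs) ≤ y + ascents (map f xs) ⇔ descents xs ≤ y + ascents xs
    step xs rewrite ascents-map xs | descents-map xs = ⇔-id _

isBallotFrom-punchIn : ∀ a {y} {τ : Vec (Fin n) m} →
  IsBallotFrom y (toList (Vec.map (punchIn a) τ)) ⇔ IsBallotFrom y (toList τ)
isBallotFrom-punchIn a {y} {τ} =
  subst (λ xs → IsBallotFrom y xs ⇔ IsBallotFrom y (toList τ)) (sym (Vec.toList-map (punchIn a) τ))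
    (isBallotFrom-map (punchIn-<-⇔ a))

-- Cuts

-- A cut is a gap just below the value c, not a letter, hence a natural number: the gap c = m above
-- all letters must be allowed, since a new maximum is inserted there.
Cut : ℕ → Pred (Vec (Fin m) n) 0ℓ
Cut c = AllPairsᵛ (λ p q → ¬ (toℕ p < c × c ≤ toℕ q))

cut? : ∀ c → Decidable (Cut {m} {n} c)
cut? c = allPairs? (λ p q → ¬? ((toℕ p <? c) ×-dec (c ≤? toℕ q)))

-- The letters of τ from `a` on are raised past `a`, so a pair straddling `a` in the new word comes
-- from p < a ≤ q in τ, a violation of the cut.
avoids213-prepend : ∀ {τ : Vec (Fin n) n} {a} → Avoids213 (prepend τ a) ⇔ (Cut (toℕ a) τ × Avoids213 τ)
avoids213-prepend {a = a} =
  allPairs-map (λ p q → ¬-cong-⇔ (punchInᵢ<i-⇔ a p ×-⇔ i<punchInᵢ-⇔ a q)) ×-⇔ avoids213-map (punchIn-<-⇔ a)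

-- The new first letter is at least c, so it cannot be the small letter of a violating pair, and
-- raising letters moves none of them across c.
cut-prepend : ∀ {τ : Vec (Fin n) n} {a c} → c ≤ toℕ a → Cut c (prepend τ a) ⇔ Cut c τ
cut-prepend {n} {τ} {a} {c} c≤a = mk⇔
  (to cut-map ∘ AllPairsᵛ.tail)
  (λ cut → Allᵛ.lookup⁻ (λ _ (a<c , _) → ≤⇒≯ c≤a a<c) ∷ from cut-map cut)
  where
  cut-map : Cut c (Vec.map (punchIn a) τ) ⇔ Cut c τ
  cut-map = allPairs-map λ p q → ¬-cong-⇔ (punchIn-below-⇔ a p c≤a ×-⇔ punchIn-above-⇔ a q c≤a)

cut-zero : (τ : Vec (Fin m) n) → Cut 0 τ
cut-zero τ = allPairs-tabulate λ _ ()

cut-top : (τ : Vec (Fin m) n) → Cut m τ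
cut-top τ = allPairs-tabulate λ _ (_ , m≤q) → ≤⇒≯ m≤q (Fin.toℕ<n _)

-- As c ≤ n, the letter c itself occurs in τ, and after the smaller head; these two letters violate
-- the cut. The top gap n + 1 is not covered and is always a cut.
¬cut-above-head : ∀ (τ : Vec (Fin (suc n)) (suc n)) {c} → IsPermutation τ →
  toℕ (Vec.head τ) < c → c ≤ n → ¬ Cut c τ
¬cut-above-head {n} (h ∷ τ) {c} (_ , surj) h<c c≤n cut with surj (Fin.fromℕ< (s≤s c≤n))
... | zero  , eq = <⇒≢ h<c (trans (cong toℕ (eq refl)) (Fin.toℕ-fromℕ< (s≤s c≤n)))
... | suc i , eq = allPairs-lookup cut {zero} {suc i} z<s
  (h<c , ≤-reflexive (sym (trans (cong toℕ (eq refl)) (Fin.toℕ-fromℕ< (s≤s c≤n)))))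

-- The statistic k: the nonzero cuts not above the first letter.
sites : Vec (Fin (suc n)) (suc n) → ℕ
sites π = count⁺ (λ c → cut? c π) (toℕ (Vec.head π))

sites-prepend : ∀ (τ : Vec (Fin n) n) a → sites (prepend τ a) ≡ count⁺ (λ c → cut? c τ) (toℕ a)
sites-prepend τ a = count⁺-cong (λ c → cut? c (prepend τ a)) (λ c → cut? c τ) (toℕ a) cut-prepend

-- The effect of a new first letter

Valid : ℕ → Pred (Vec (Fin m) n) 0ℓ
Valid y π = IsBallotFrom y (toList π) × Avoids213 π

valid? : ∀ y → Decidable (Valid {m} {n} y)
valid? y π = isBallotFrom? y (toList π) ×-dec avoids213? π

-- φ stays an arbitrary function of k because the recursion replaces it by its partial sums and by
-- its shift.
weight : ℕ → (ℕ → ℕ) → Vec (Fin (suc n)) (suc n) → ℕ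
weight y φ π = ⟦ valid? y π ⟧ * φ (sites π)

-- Equality with the head is allowed: the old head is then raised above the new letter, and an
-- ascent results.
valid-ascent : ∀ {τ : Vec (Fin (suc n)) (suc n)} {a y} → toℕ a ≤ toℕ (Vec.head τ) →
  Valid y (prepend τ a) ⇔ (Valid (suc y) τ × Cut (toℕ a) τ)
valid-ascent {τ = h ∷ τ} {a} {y} a≤h = mk⇔
  (λ (ballot , avoids) → let cut , avoids′ = to avoids213-prepend avoids in (to ballot⇔ ballot , avoids′) , cut)
  (λ ((ballot , avoids) , cut) → from ballot⇔ ballot , from avoids213-prepend (cut , avoids))
  where
  ballot⇔ : IsBallotFrom y (toList (prepend (h ∷ τ) a)) ⇔ IsBallotFrom (suc y) (toList (h ∷ τ))
  ballot⇔ = isBallotFrom-punchIn a ⇔-∘ isBallotFrom-ascent (from (i<punchInᵢ-⇔ a h) a≤h)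

valid-descent : ∀ {τ : Vec (Fin (suc n)) (suc n)} {a y} → toℕ (Vec.head τ) < toℕ a →
  Valid (suc y) (prepend τ a) ⇔ (Valid y τ × Cut (toℕ a) τ)
valid-descent {τ = h ∷ τ} {a} {y} h<a = mk⇔
  (λ (ballot , avoids) → let cut , avoids′ = to avoids213-prepend avoids in (to ballot⇔ ballot , avoids′) , cut)
  (λ ((ballot , avoids) , cut) → from ballot⇔ ballot , from avoids213-prepend (cut , avoids))
  where
  ballot⇔ : IsBallotFrom (suc y) (toList (prepend (h ∷ τ) a)) ⇔ IsBallotFrom y (toList (h ∷ τ))
  ballot⇔ = isBallotFrom-punchIn a ⇔-∘ isBallotFrom-descent (from (punchInᵢ<i-⇔ a h) h<a)

¬valid-descent : ∀ {τ : Vec (Fin (suc n)) (suc n)} {a} → toℕ (Vec.head τ) < toℕ a → ¬ Valid 0 (prepend τ a)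
¬valid-descent {τ = h ∷ τ} {a} h<a (ballot , _) = ¬isBallotFrom-descent (from (punchInᵢ<i-⇔ a h) h<a) ballot

∑-weight-prepend : ∀ (τ : Vec (Fin (suc n)) (suc n)) → IsPermutation τ → ∀ y φ →
  ∑ (allFin (2 + n)) (λ a → weight y φ (prepend τ a)) ≡
  weight (suc y) (λ k → ∑ (upTo (suc k)) φ) τ + below y (λ y′ → weight y′ (φ ∘ suc) τ)
∑-weight-prepend {n} τ perm y φ = begin
  ∑ (allFin (2 + n)) (λ a → weight y φ (prepend τ a))
    -- The split is at `suc h` since a = h still gives an ascent.
    ≡⟨ ∑-allFin-split (suc h) _ _ h<1+n (λ a a<1+h → ascent a (s≤s⁻¹ a<1+h)) (nonMaximalDescent y) ⟩
  ∑ (upTo (suc h)) (λ c → ⟦ valid? (suc y) τ ⟧ * (⟦ cut? c τ ⟧ * φ (count c))) + weight y φ (prepend τ max)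
    ≡⟨ cong₂ _+_
         -- `∑-count⁺` reindexes the cuts c ≤ h by the new value of k, which runs through 0, ...,
         -- `sites τ`.
         (trans (∑-*ˡ ⟦ valid? (suc y) τ ⟧ (upTo (suc h)) (λ c → ⟦ cut? c τ ⟧ * φ (count c)))
                (cong (⟦ valid? (suc y) τ ⟧ *_) (∑-count⁺ (λ c → cut? c τ) (cut-zero τ) φ h)))
         (maximalDescent y) ⟩
  weight (suc y) (λ k → ∑ (upTo (suc k)) φ) τ + below y (λ y′ → weight y′ (φ ∘ suc) τ)
    ∎
  where
  h = toℕ (Vec.head τ)

  h<1+n : h < suc n
  h<1+n = Fin.toℕ<n (Vec.head τ)

  max : Fin (2 + n)
  max = fromℕ (suc n)

  count : ℕ → ℕ
  count = count⁺ (λ c → cut? c τ)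

  ascent : ∀ a → toℕ a ≤ h →
    weight y φ (prepend τ a) ≡ ⟦ valid? (suc y) τ ⟧ * (⟦ cut? (toℕ a) τ ⟧ * φ (count (toℕ a)))
  ascent a a≤h = begin
    weight y φ (prepend τ a)
      ≡⟨ cong₂ _*_ (⟦⟧-⇔ (valid? y (prepend τ a)) (valid? (suc y) τ ×-dec cut? (toℕ a) τ) (valid-ascent a≤h))
                   (cong φ (sites-prepend τ a)) ⟩
    ⟦ valid? (suc y) τ ×-dec cut? (toℕ a) τ ⟧ * φ (count (toℕ a))
      ≡⟨ cong (_* φ (count (toℕ a))) (⟦⟧-× (valid? (suc y) τ) (cut? (toℕ a) τ)) ⟩
    ⟦ valid? (suc y) τ ⟧ * ⟦ cut? (toℕ a) τ ⟧ * φ (count (toℕ a))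
      ≡⟨ *-assoc ⟦ valid? (suc y) τ ⟧ _ _ ⟩
    ⟦ valid? (suc y) τ ⟧ * (⟦ cut? (toℕ a) τ ⟧ * φ (count (toℕ a)))
      ∎

  nonMaximalDescent : ∀ y a → h < toℕ a → toℕ a < suc n → weight y φ (prepend τ a) ≡ 0
  nonMaximalDescent y a h<a a<1+n = cong (_* φ (sites (prepend τ a)))
    (⟦⟧-false (valid? y (prepend τ a)) λ (_ , avoids) →
      ¬cut-above-head τ perm h<a (s≤s⁻¹ a<1+n) (proj₁ (to avoids213-prepend avoids)))

  h<max : h < toℕ max
  h<max = subst (h <_) (sym (Fin.toℕ-fromℕ (suc n))) h<1+n

  sites-max : sites (prepend τ max) ≡ suc (sites τ)
  sites-max = begin
    sites (prepend τ max)
      ≡⟨ sites-prepend τ max ⟩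
    count (toℕ max)
      ≡⟨ cong count (Fin.toℕ-fromℕ (suc n)) ⟩
    ⟦ cut? (suc n) τ ⟧ + count n
      -- The top gap is one more cut, and there is none between the head and n.
      ≡⟨ cong₂ _+_ (⟦⟧-true (cut? (suc n) τ) (cut-top τ))
           (count⁺-extend (λ c → cut? c τ) (≤⇒≤′ (s≤s⁻¹ h<1+n)) (¬cut-above-head τ perm)) ⟩
    suc (sites τ)
      ∎

  maximalDescent : ∀ y → weight y φ (prepend τ max) ≡ below y (λ y′ → weight y′ (φ ∘ suc) τ)
  maximalDescent zero    = cong (_* φ (sites (prepend τ max)))
    (⟦⟧-false (valid? 0 (prepend τ max)) (¬valid-descent h<max))
  maximalDescent (suc y) = cong₂ _*_
    (⟦⟧-⇔ (valid? (suc y) (prepend τ max)) (valid? y τ) (mk⇔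
      (proj₁ ∘ to (valid-descent h<max))
      (λ valid → from (valid-descent h<max)
        (valid , subst (λ c → Cut c τ) (sym (Fin.toℕ-fromℕ (suc n))) (cut-top τ)))))
    (cong φ sites-max)

-- Weighted enumeration

-- The permutations have n + 1 letters, so n counts their adjacent pairs, the analogue of the n
-- steps of a walk.
total : ℕ → ℕ → (ℕ → ℕ) → ℕ
total n y φ = ∑ (perms (suc n)) (weight y φ)

total-cong : ∀ n y {φ ψ : ℕ → ℕ} → (∀ k → φ k ≡ ψ k) → total n y φ ≡ total n y ψ
total-cong n y φ≡ψ = ∑-cong (perms (suc n)) λ π → cong (⟦ valid? y π ⟧ *_) (φ≡ψ (sites π))

total-+ : ∀ n y φ ψ → total n y (λ k → φ k + ψ k) ≡ total n y φ + total n y ψ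
total-+ n y φ ψ = trans
  (∑-cong (perms (suc n)) λ π → *-distribˡ-+ ⟦ valid? y π ⟧ (φ (sites π)) (ψ (sites π)))
  (∑-+ (perms (suc n)) (weight y φ) (weight y ψ))

total-zero : ∀ y φ → total 0 y φ ≡ φ 0
total-zero y φ = begin
  weight y φ π + 0        ≡⟨ +-identityʳ _ ⟩
  ⟦ valid? y π ⟧ * φ 0    ≡⟨ cong (_* φ 0) (⟦⟧-true (valid? y π) (z≤n ∷ z≤n ∷ [] , [] , tt)) ⟩
  1 * φ 0                 ≡⟨ *-identityˡ (φ 0) ⟩
  φ 0                     ∎
  where
  π : Vec (Fin 1) 1
  π = 0F ∷ []

-- Ascents send k to each of 0, ..., k, which turns φ into its partial sums; a descent sends k to k
-- + 1, which shifts φ and uses up one unit of height.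
total-suc : ∀ n y φ → total (suc n) y φ ≡
  total n (suc y) (λ k → ∑ (upTo (suc k)) φ) + below y (λ y′ → total n y′ (φ ∘ suc))
total-suc n y φ = begin
  total (suc n) y φ
    ≡⟨ ∑-cartesianProductWith prepend (perms (suc n)) (allFin (2 + n)) (weight y φ) ⟩
  ∑ (perms (suc n)) (λ τ → ∑ (allFin (2 + n)) (λ a → weight y φ (prepend τ a)))
    ≡⟨ ∑-cong-∈ (perms (suc n)) (λ τ τ∈ → ∑-weight-prepend τ (∈-perms⁻ τ∈) y φ) ⟩
  ∑ (perms (suc n)) (λ τ → weight (suc y) (λ k → ∑ (upTo (suc k)) φ) τ + below y (λ y′ → weight y′ (φ ∘ suc) τ))
    ≡⟨ ∑-+ (perms (suc n)) (weight (suc y) (λ k → ∑ (upTo (suc k)) φ)) _ ⟩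
  total n (suc y) (λ k → ∑ (upTo (suc k)) φ) + ∑ (perms (suc n)) (λ τ → below y (λ y′ → weight y′ (φ ∘ suc) τ))
    ≡⟨ cong (λ t → total n (suc y) (λ k → ∑ (upTo (suc k)) φ) + t) (∑-below y) ⟩
  total n (suc y) (λ k → ∑ (upTo (suc k)) φ) + below y (λ y′ → total n y′ (φ ∘ suc))
    ∎
  where
  ∑-below : ∀ y → ∑ (perms (suc n)) (λ τ → below y (λ y′ → weight y′ (φ ∘ suc) τ)) ≡
    below y (λ y′ → total n y′ (φ ∘ suc))
  ∑-below zero    = ∑-zero (perms (suc n))
  ∑-below (suc y) = refl

-- Binomial weights and Gessel walks

hockey-stick : ∀ k x → ∑ (upTo (suc k)) (_C x) ≡ suc k C suc x
hockey-stick zero    x = begin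
  -- The zero is read as `0 C suc x`, so that Pascal's rule applies.
  0 C x + 0           ≡⟨ cong (0 C x +_) (k>n⇒nCk≡0 {0} {suc x} z<s) ⟨
  0 C x + 0 C suc x   ≡⟨ nCk+nC[k+1]≡[n+1]C[k+1] 0 x ⟩
  1 C suc x           ∎
hockey-stick (suc k) x = begin
  ∑ (upTo (2 + k)) (_C x)                ≡⟨ ∑-upTo-last (suc k) (_C x) ⟩
  ∑ (upTo (suc k)) (_C x) + suc k C x    ≡⟨ cong (_+ suc k C x) (hockey-stick k x) ⟩
  suc k C suc x + suc k C x              ≡⟨ +-comm (suc k C suc x) _ ⟩
  suc k C x + suc k C suc x              ≡⟨ nCk+nC[k+1]≡[n+1]C[k+1] (suc k) x ⟩
  (2 + k) C suc x                        ∎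

total-C≡gessel : ∀ n x y → total n y (_C x) ≡ gessel n x y
total-C≡gessel zero    zero    y = total-zero y (_C 0)
total-C≡gessel zero    (suc x) y = trans (total-zero y (_C suc x)) (k>n⇒nCk≡0 {0} {suc x} z<s)
total-C≡gessel (suc n) x y = begin
  total (suc n) y (_C x)
    ≡⟨ total-suc n y (_C x) ⟩
  total n (suc y) (λ k → ∑ (upTo (suc k)) (_C x)) + below y (λ y′ → total n y′ (λ k → suc k C x))
    ≡⟨ cong₂ _+_ ascents≡ (descents≡ y x) ⟩
  (gessel n x (suc y) + gessel n (suc x) (suc y)) +
  (below y (gessel n x) + below y (λ y′ → below x (λ x′ → gessel n x′ y′)))
    -- The ascents gave N and NE, the descents S and SW; the terms are reordered to N, S, NE, SW.
    ≡⟨ ∙-interchange +-commutativeSemigroup (gessel n x (suc y)) _ _ _ ⟩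
  (gessel n x (suc y) + below y (gessel n x)) +
  (gessel n (suc x) (suc y) + below y (λ y′ → below x (λ x′ → gessel n x′ y′)))
    ≡⟨ +-assoc (gessel n x (suc y)) _ _ ⟩
  gessel (suc n) x y
    ∎
  where
  ascents≡ : total n (suc y) (λ k → ∑ (upTo (suc k)) (_C x)) ≡ gessel n x (suc y) + gessel n (suc x) (suc y)
  ascents≡ = begin
    total n (suc y) (λ k → ∑ (upTo (suc k)) (_C x))
      ≡⟨ total-cong n (suc y) (λ k → trans (hockey-stick k x) (sym (nCk+nC[k+1]≡[n+1]C[k+1] k x))) ⟩
    total n (suc y) (λ k → k C x + k C suc x)
      ≡⟨ total-+ n (suc y) (_C x) (_C suc x) ⟩
    total n (suc y) (_C x) + total n (suc y) (_C suc x)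
      ≡⟨ cong₂ _+_ (total-C≡gessel n x (suc y)) (total-C≡gessel n (suc x) (suc y)) ⟩
    gessel n x (suc y) + gessel n (suc x) (suc y)
      ∎

  descents≡ : ∀ y x → below y (λ y′ → total n y′ (λ k → suc k C x)) ≡
    below y (gessel n x) + below y (λ y′ → below x (λ x′ → gessel n x′ y′))
  descents≡ zero    x       = refl
  -- Both `suc k C 0` and `k C 0` compute to 1, and on the vertical axis there is no SW step.
  descents≡ (suc y) zero    = trans (total-C≡gessel n zero y) (sym (+-identityʳ _))
  descents≡ (suc y) (suc x) = begin
    total n y (λ k → suc k C suc x)
      ≡⟨ total-cong n y (λ k → trans (sym (nCk+nC[k+1]≡[n+1]C[k+1] k x)) (+-comm (k C x) _)) ⟩
    total n y (λ k → k C suc x + k C x)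
      ≡⟨ total-+ n y (_C suc x) (_C x) ⟩
    total n y (_C suc x) + total n y (_C x)
      ≡⟨ cong₂ _+_ (total-C≡gessel n (suc x) y) (total-C≡gessel n x y) ⟩
    gessel n (suc x) y + gessel n x y
      ∎

-- Passage to the enumerated sets

∣𝓑[213]∣≡total : ∀ n → ∣ 𝓑[ pattern213 ]? (suc n) ∣ ≡ total n 0 (_C 0)
∣𝓑[213]∣≡total n = begin
  ∣ 𝓑[ pattern213 ]? (suc n) ∣
    ≡⟨ Unique⇒length-≡ (filter⁺ (𝓑[ pattern213 ]? (suc n)) (unique finite-Vec))
                       (filter⁺ (valid? 0) (perms-unique (suc n)))
                       (mk⇔ to′ from′) ⟩
  length (filter (valid? 0) (perms (suc n)))
    ≡⟨ length-filter-∑ (valid? 0) (perms (suc n)) ⟩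
  ∑ (perms (suc n)) (λ π → ⟦ valid? 0 π ⟧)
    -- The weight `_C 0` is constantly 1, so every valid permutation counts once.
    ≡⟨ ∑-cong (perms (suc n)) (λ π → sym (*-identityʳ ⟦ valid? 0 π ⟧)) ⟩
  total n 0 (_C 0)
    ∎
  where
  all : List (Vec (Fin (suc n)) (suc n))
  all = elements finite-Vec

  to′ : ∀ {π} → π ∈ filter (𝓑[ pattern213 ]? (suc n)) all → π ∈ filter (valid? 0) (perms (suc n))
  to′ π∈ with _ , (perm , ballot) , ¬contains ← ∈-filter⁻ (𝓑[ pattern213 ]? (suc n)) {xs = all} π∈ =
    ∈-filter⁺ (valid? 0) (∈-perms⁺ perm) (ballot , from avoids213⇔¬contains ¬contains)

  from′ : ∀ {π} → π ∈ filter (valid? 0) (perms (suc n)) → π ∈ filter (𝓑[ pattern213 ]? (suc n)) all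
  from′ π∈ with π∈perms , ballot , avoids ← ∈-filter⁻ (valid? 0) π∈ =
    ∈-filter⁺ (𝓑[ pattern213 ]? (suc n)) (complete finite-Vec _)
      ((∈-perms⁻ π∈perms , ballot) , to avoids213⇔¬contains avoids)

theorem1p4 : (n : ℕ) →
    ∣ 𝓑[ pattern213 ]? (suc n) ∣ ≡ sum (map (λ j → ∣ 𝓖? n 0 j ∣) (upTo (suc n)))
theorem1p4 n = begin
  ∣ 𝓑[ pattern213 ]? (suc n) ∣
    ≡⟨ ∣𝓑[213]∣≡total n ⟩
  total n 0 (_C 0)
    ≡⟨ total-C≡gessel n 0 0 ⟩
  gessel n 0 0
    -- From height 0 the final height is at most n, so the bound `suc n` is just large enough.
    ≡⟨ walks≡gessel n 0 0 ≤-refl ⟨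
  walks n (0ℤ , 0ℤ) (suc n)
    -- `𝓖? n 0 j` and `walkTo? (0ℤ , 0ℤ) j` unfold to the same decision procedure.
    ≡⟨ ∑-cong (upTo (suc n)) (λ j → length-filter-∑ (𝓖? n 0 j) (stepSequences n)) ⟨
  sum (map (λ j → ∣ 𝓖? n 0 j ∣) (upTo (suc n)))
    ∎
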